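{- Let $\mathcal{C}$ be a nondegenerate $[n,k]_{q^m/q}$ code with $n\ge(k-1)m+1$. Then $\mathcal{C}$ is minimal.
   Context: Let $q$ be a prime power and $n,m,k$ positive integers. For $v\in\mathbb{F}_{q^m}^n$ and an ordered basis $\Gamma=(\gamma_1,\dots,\gamma_m)$ of $\mathbb{F}_{q^m}$ over $\mathbb{F}_q$, let $\Gamma(v)\in\mathbb{F}_q^{n\times m}$ be the matrix with $v_i=\sum_{j}\Gamma(v)_{ij}\gamma_j$. The rank support $\sigma^{\mathrm{rk}}(v)\subseteq\mathbb{F}_q^n$ is the column space of $\Gamma(v)$ (independent of $\Gamma$). An $[n,k]_{q^m/q}$ code is a $k$-dimensional $\mathbb{F}_{q^m}$-subspace $\mathcal{C}\subseteq\mathbb{F}_{q^m}^n$; it is nondegenerate if $\sum_{v\in\mathcal{C}}\sigma^{\mathrm{rk}}(v)=\mathbb{F}_q^n$, and it is minimal if for all $v,v'\in\mathcal{C}$, $\sigma^{\mathrm{rk}}(v')\subseteq\sigma^{\mathrm{rk}}(v)$ implies $v'=\alpha v$ for some $\alpha\in\mathbb{F}_{q^m}$. -}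

module Defs where

open import Level using (Level; _⊔_; suc)
open import Algebra.Bundles using (CommutativeRing)
open import Algebra.Apartness.Bundles using (HeytingField; HeytingCommutativeRing)
open import Algebra.Module.Bundles using (Module)
open import Algebra.Module.Structures.Biased using (IsModuleFromLeft)
import Algebra.Module.Construct.TensorUnit as TensorUnit
open import Algebra.Morphism.Structures using (IsRingMonomorphism)
open import Data.Fin.Base using (Fin)
open import Data.Nat.Base as ℕ using (ℕ)
open import Data.Nat.Primality using (Prime)
open import Data.Product.Base using (_×_; _,_; ∃; ∃-syntax; proj₁; proj₂)
open import Data.Vec.Functional using (Vector; transpose)
import Algebra.Definitions.RawMonoid as RawMonoidDefs
open import Function.Bundles using (Inverse)
open import Relation.Binary.Bundles using (Setoid)
open import Relation.Binary.PropositionalEquality using (_≡_)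
import Relation.Binary.PropositionalEquality as ≡
open import Relation.Unary using (Pred; _∈_; _⊆_; _≐_; U)

IsPrimePower : ℕ → Set
IsPrimePower q = ∃[ p ] ∃[ e ] Prime p × q ≡ p ℕ.^ ℕ.suc e

HasOrder : ∀ {a ℓ} → Setoid a ℓ → ℕ → Set (a ⊔ ℓ)
HasOrder S n = Inverse S (≡.setoid (Fin n))

fieldRing : ∀ {c ℓ₁ ℓ₂} → HeytingField c ℓ₁ ℓ₂ → CommutativeRing c ℓ₁
fieldRing K = HeytingCommutativeRing.commutativeRing (HeytingField.heytingCommutativeRing K)

-- On a finite carrier both equality and invertibility are decidable, so there
-- a Heyting field is the same thing as a classical field, with _#_ being _≉_.
record FiniteFieldExtension (c ℓ₁ ℓ₂ : Level) (q m : ℕ) : Set (suc (c ⊔ ℓ₁ ⊔ ℓ₂)) where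
  field
    base : HeytingField c ℓ₁ ℓ₂
    ext  : HeytingField c ℓ₁ ℓ₂

  F : CommutativeRing c ℓ₁
  F = fieldRing base

  L : CommutativeRing c ℓ₁
  L = fieldRing ext

  module F = CommutativeRing F
  module L = CommutativeRing L

  field
    F-order : HasOrder F.setoid q
    L-order : HasOrder L.setoid (q ℕ.^ m)
    ι       : F.Carrier → L.Carrier
    ι-mono  : IsRingMonomorphism F.rawRing L.rawRing ι

module _ {r ℓr a ℓa} {R : CommutativeRing r ℓr} (M : Module R a ℓa) where

  private
    module R = CommutativeRing R
    module M = Module M

  sumᴹ : ∀ {t} → Vector M.Carrierᴹ t → M.Carrierᴹ
  sumᴹ = RawMonoidDefs.sum M.+ᴹ-rawMonoid

  linComb : ∀ {t} → Vector R.Carrier t → Vector M.Carrierᴹ t → M.Carrierᴹ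
  linComb c v = sumᴹ (λ i → c i M.*ₗ v i)

  Span : ∀ {t} → Vector M.Carrierᴹ t → Pred M.Carrierᴹ (r ⊔ ℓa)
  Span v x = ∃[ c ] x M.≈ᴹ linComb c v

  LinearlyIndependent : ∀ {t} → Vector M.Carrierᴹ t → Set (r ⊔ ℓr ⊔ ℓa)
  LinearlyIndependent v = ∀ c → linComb c v M.≈ᴹ M.0ᴹ → ∀ i → c i R.≈ R.0#

  record IsSubspace {p} (P : Pred M.Carrierᴹ p) : Set (r ⊔ a ⊔ ℓa ⊔ p) where
    field
      respects : ∀ {x y} → x M.≈ᴹ y → x ∈ P → y ∈ P
      0ᴹ∈      : M.0ᴹ ∈ P
      +ᴹ∈      : ∀ {x y} → x ∈ P → y ∈ P → x M.+ᴹ y ∈ P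
      *ₗ∈      : ∀ α {x} → x ∈ P → α M.*ₗ x ∈ P

  record IsBasis {p} (P : Pred M.Carrierᴹ p) {t} (b : Vector M.Carrierᴹ t)
                 : Set (r ⊔ ℓr ⊔ a ⊔ ℓa ⊔ p) where
    field
      members     : ∀ i → b i ∈ P
      independent : LinearlyIndependent b
      spanning    : P ⊆ Span b

  HasDimension : ∀ {p} → Pred M.Carrierᴹ p → ℕ → Set (r ⊔ ℓr ⊔ a ⊔ ℓa ⊔ p)
  HasDimension P t = ∃[ b ] IsBasis P {t} b

  SumOf : ∀ {i s} {I : Set i} → (I → Pred M.Carrierᴹ s) → Pred M.Carrierᴹ (i ⊔ s ⊔ a ⊔ ℓa)
  SumOf {I = I} S x =
    ∃[ t ] ∃[ u ] ((j : Fin t) → ∃[ i ] u j ∈ S i) × x M.≈ᴹ sumᴹ u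

power : ∀ {r ℓr a ℓa} {R : CommutativeRing r ℓr} → Module R a ℓa → ℕ → Module R a ℓa
power {R = R} M n = record
  { Carrierᴹ = Vector M.Carrierᴹ n
  ; _≈ᴹ_     = λ x y → ∀ i → x i M.≈ᴹ y i
  ; _+ᴹ_     = λ x y i → x i M.+ᴹ y i
  ; _*ₗ_     = λ α x i → α M.*ₗ x i
  ; _*ᵣ_     = λ x α i → α M.*ₗ x i
  ; 0ᴹ       = λ _ → M.0ᴹ
  ; -ᴹ_      = λ x i → M.-ᴹ x i
  ; isModule = IsModuleFromLeft.isModule {commutativeRing = R} record
    { isLeftModule = record
      { isLeftSemimodule = record
        { +ᴹ-isCommutativeMonoid = record
          { isMonoid = record
            { isSemigroup = record
              { isMagma = record
                { isEquivalence = record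
                  { refl  = λ _ → M.≈ᴹ-refl
                  ; sym   = λ e i → M.≈ᴹ-sym (e i)
                  ; trans = λ e f i → M.≈ᴹ-trans (e i) (f i)
                  }
                ; ∙-cong = λ e f i → M.+ᴹ-cong (e i) (f i)
                }
              ; assoc = λ x y z i → M.+ᴹ-assoc (x i) (y i) (z i)
              }
            ; identity = (λ x i → M.+ᴹ-identityˡ (x i)) , (λ x i → M.+ᴹ-identityʳ (x i))
            }
          ; comm = λ x y i → M.+ᴹ-comm (x i) (y i)
          }
        ; isPreleftSemimodule = record
          { *ₗ-cong      = λ e f i → M.*ₗ-cong e (f i)
          ; *ₗ-zeroˡ     = λ x i → M.*ₗ-zeroˡ (x i)
          ; *ₗ-distribʳ  = λ x α β i → M.*ₗ-distribʳ (x i) α β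
          ; *ₗ-identityˡ = λ x i → M.*ₗ-identityˡ (x i)
          ; *ₗ-assoc     = λ α β x i → M.*ₗ-assoc α β (x i)
          ; *ₗ-zeroʳ     = λ α i → M.*ₗ-zeroʳ α
          ; *ₗ-distribˡ  = λ α x y i → M.*ₗ-distribˡ α (x i) (y i)
          }
        }
      ; -ᴹ‿cong    = λ e i → M.-ᴹ‿cong (e i)
      ; -ᴹ‿inverse = (λ x i → M.-ᴹ‿inverseˡ (x i)) , (λ x i → M.-ᴹ‿inverseʳ (x i))
      }
    }
  }
  where module M = Module M

coordinateSpace : ∀ {r ℓr} (R : CommutativeRing r ℓr) → ℕ → Module R r ℓr
coordinateSpace R = power {R = R} (TensorUnit.⟨module⟩ {R = R})

columnSpace : ∀ {r ℓr} (R : CommutativeRing r ℓr) {n m} →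
              Vector (Vector (CommutativeRing.Carrier R) m) n →
              Pred (Vector (CommutativeRing.Carrier R) n) (r ⊔ ℓr)
columnSpace R {n} A = Span (coordinateSpace R n) (transpose A)

module _ {c ℓ₁ ℓ₂ : Level} {q m : ℕ} (E : FiniteFieldExtension c ℓ₁ ℓ₂ q m) where

  open FiniteFieldExtension E
  open IsRingMonomorphism ι-mono

  L/F : Module F c ℓ₁
  L/F = record
    { Carrierᴹ = L.Carrier
    ; _≈ᴹ_     = L._≈_
    ; _+ᴹ_     = L._+_
    ; _*ₗ_     = λ a x → ι a L.* x
    ; _*ᵣ_     = λ x a → ι a L.* x
    ; 0ᴹ       = L.0#
    ; -ᴹ_      = L.-_
    ; isModule = IsModuleFromLeft.isModule {commutativeRing = F} record
      { isLeftModule = record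
        { isLeftSemimodule = record
          { +ᴹ-isCommutativeMonoid = L.+-isCommutativeMonoid
          ; isPreleftSemimodule = record
            { *ₗ-cong      = λ e f → L.*-cong (⟦⟧-cong e) f
            ; *ₗ-zeroˡ     = λ x → L.trans (L.*-congʳ 0#-homo) (L.zeroˡ x)
            ; *ₗ-distribʳ  = λ x a b → L.trans (L.*-congʳ (+-homo a b)) (L.distribʳ x (ι a) (ι b))
            ; *ₗ-identityˡ = λ x → L.trans (L.*-congʳ 1#-homo) (L.*-identityˡ x)
            ; *ₗ-assoc     = λ a b x → L.trans (L.*-congʳ (*-homo a b)) (L.*-assoc (ι a) (ι b) x)
            ; *ₗ-zeroʳ     = λ a → L.zeroʳ (ι a)
            ; *ₗ-distribˡ  = λ a x y → L.distribˡ (ι a) x y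
            }
          }
        ; -ᴹ‿cong    = L.-‿cong
        ; -ᴹ‿inverse = L.-‿inverse
        }
      }
    }

  record OrderedBasis : Set (c ⊔ ℓ₁) where
    field
      γ       : Vector L.Carrier m
      isBasis : IsBasis L/F U γ

    coordinates : L.Carrier → Vector F.Carrier m
    coordinates x = proj₁ (IsBasis.spanning isBasis {x} _)

    -- v i = Σⱼ ι (expand v i j) * γ j
    expand : ∀ {n} → Vector L.Carrier n → Vector (Vector F.Carrier m) n
    expand v i = coordinates (v i)

  -- Changing Γ multiplies the expansion on the right by an invertible matrix
  -- over F, so this column space does not depend on Γ.
  rankSupport : OrderedBasis → ∀ {n} → Vector L.Carrier n →
                Pred (Vector F.Carrier n) (c ⊔ ℓ₁)
  rankSupport Γ v = columnSpace F (OrderedBasis.expand Γ v)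

  record Code (p : Level) (n k : ℕ) : Set (c ⊔ ℓ₁ ⊔ suc p) where
    field
      words      : Pred (Vector L.Carrier n) p
      isSubspace : IsSubspace (coordinateSpace L n) words
      dimension  : HasDimension (coordinateSpace L n) words k

  module _ (Γ : OrderedBasis) {p : Level} {n k : ℕ} (C : Code p n k) where

    open Code C

    Nondegenerate : Set (c ⊔ ℓ₁ ⊔ p)
    Nondegenerate =
      SumOf (coordinateSpace F n) {I = ∃ words} (λ v → rankSupport Γ (proj₁ v)) ≐ U

    Minimal : Set (c ⊔ ℓ₁ ⊔ p)
    Minimal = ∀ v v′ → v ∈ words → v′ ∈ words →
      rankSupport Γ v′ ⊆ rankSupport Γ v →
      ∃[ α ] (∀ i → v′ i L.≈ α L.* v i)

{-# OPTIONS --safe #-}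
-- A vector μ ∈ Fⁿ is orthogonal to the rank support of v exactly when
-- Σᵢ μᵢ vᵢ = 0 in L.  If σ(v′) ⊆ σ(v) but v′ is not a multiple of v, then by
-- exchange C is spanned by v, v′ and k − 2 vectors of a basis, so a μ that kills
-- v and those k − 2 vectors kills all of C, and nondegeneracy forces μ = 0.
-- Hence μ ↦ (its k − 1 products) is an injection Fⁿ → L^(k − 1), and counting
-- elements gives n ≤ (k − 1) m.
module Submission where

open import Level using (Level)
open import Algebra.Apartness.Bundles using (HeytingField)
open import Algebra.Bundles using (CommutativeRing)
open import Algebra.Module.Bundles using (Module)
open import Algebra.Morphism.Structures using (IsRingMonomorphism)
open import Data.Fin.Base using (Fin; zero; suc; combine; funToFin; finToFun; punchIn; punchOut)
open import Data.Fin.Properties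
  using (_≟_; all?; any?; ¬∀⟶∃¬; inj⇒≟; injective⇒≤; punchInᵢ≢i; punchIn-punchOut;
         funToFin-finToFin; finToFun-funToFin)
open import Data.Nat.Base as ℕ using (ℕ; _+_; _*_; _∸_; _≥_)
import Data.Nat.Properties as ℕₚ
open import Data.Nat.Primality using (prime⇒nonTrivial; prime⇒nonZero)
open import Data.Product.Base using (_,_; ∃-syntax; proj₁; proj₂)
open import Data.Vec.Functional using (Vector; transpose; updateAt; removeAt)
open import Data.Vec.Functional.Properties using (updateAt-updates; updateAt-minimal)
open import Defs
open import Function.Base using (_∘_; const)
open import Function.Bundles using (Injection; Inverse)
open import Function.Properties.Inverse using (Inverse⇒Injection)
import Function.Construct.Symmetry as Symmetry
open import Relation.Binary.Definitions using (Decidable)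
open import Relation.Binary.PropositionalEquality as ≡ using (_≡_; _≢_)
open import Relation.Nullary using (¬_; yes; no; contradiction)
open import Relation.Unary using (Pred; _∈_; _⊆_)
import Algebra.Properties.AbelianGroup as AbelianGroupProperties
import Algebra.Properties.Ring as RingProperties
import Algebra.Properties.Semiring.Sum as SemiringSum
import Relation.Binary.Reasoning.Setoid as SetoidReasoning

-- Closure of subspaces under finite sums and spans

module _ {r ℓr a ℓa p} {R : CommutativeRing r ℓr} (M : Module R a ℓa)
         {P : Pred (Module.Carrierᴹ M) p} (P-isSubspace : IsSubspace M P) where

  open IsSubspace P-isSubspace

  sumᴹ∈ : ∀ {t} {u : Vector (Module.Carrierᴹ M) t} → (∀ j → u j ∈ P) → sumᴹ M u ∈ P
  sumᴹ∈ {ℕ.zero}  u∈P = 0ᴹ∈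
  sumᴹ∈ {ℕ.suc t} u∈P = +ᴹ∈ (u∈P zero) (sumᴹ∈ (u∈P ∘ suc))

  Span⊆ : ∀ {t} {u : Vector (Module.Carrierᴹ M) t} → (∀ j → u j ∈ P) → Span M u ⊆ P
  Span⊆ u∈P (c , x≈cu) =
    respects (Module.≈ᴹ-sym M x≈cu) (sumᴹ∈ (λ j → *ₗ∈ (c j) (u∈P j)))

-- Dot products over a commutative ring

module DotProduct {r ℓr} (R : CommutativeRing r ℓr) where

  open CommutativeRing R hiding (zero) renaming (_+_ to _⊕_; _*_ to _⊛_; _-_ to _⊖_)
  open SemiringSum semiring
  open RingProperties ring using (-1*x≈-x)
  open SetoidReasoning setoid

  infix 8 _·_

  _·_ : ∀ {n} → Vector Carrier n → Vector Carrier n → Carrier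
  x · y = sum (λ i → x i ⊛ y i)

  ·-cong : ∀ {n} {x x′ y y′ : Vector Carrier n} →
           (∀ i → x i ≈ x′ i) → (∀ i → y i ≈ y′ i) → x · y ≈ x′ · y′
  ·-cong x≈x′ y≈y′ = sum-cong-≋ (λ i → *-cong (x≈x′ i) (y≈y′ i))

  ·-comm : ∀ {n} (x y : Vector Carrier n) → x · y ≈ y · x
  ·-comm x y = sum-cong-≋ (λ i → *-comm (x i) (y i))

  sum-zero : ∀ {n} {x : Vector Carrier n} → (∀ i → x i ≈ 0#) → sum x ≈ 0#
  sum-zero {n} x≈0 = trans (sum-cong-≋ x≈0) (sum-replicate-zero n)

  ·-zeroˡ : ∀ {n} {x : Vector Carrier n} y → (∀ i → x i ≈ 0#) → x · y ≈ 0#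
  ·-zeroˡ y x≈0 = sum-zero (λ i → trans (*-congʳ (x≈0 i)) (zeroˡ (y i)))

  ·-zeroʳ : ∀ {n} (x : Vector Carrier n) {y} → (∀ i → y i ≈ 0#) → x · y ≈ 0#
  ·-zeroʳ x y≈0 = trans (·-comm x _) (·-zeroˡ x y≈0)

  ·-distribʳ-+ : ∀ {n} (x y z : Vector Carrier n) →
                 (λ i → x i ⊕ y i) · z ≈ x · z ⊕ y · z
  ·-distribʳ-+ x y z =
    trans (sum-cong-≋ (λ i → distribʳ (z i) (x i) (y i))) (∑-distrib-+ (λ i → x i ⊛ z i) (λ i → y i ⊛ z i))

  ·-scaleˡ : ∀ {n} α (x y : Vector Carrier n) → (λ i → α ⊛ x i) · y ≈ α ⊛ x · y
  ·-scaleˡ α x y =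
    trans (sum-cong-≋ (λ i → *-assoc α (x i) (y i))) (sym (*-distribˡ-sum α (λ i → x i ⊛ y i)))

  ·-distribʳ-- : ∀ {n} (x y z : Vector Carrier n) →
                 (λ i → x i ⊖ y i) · z ≈ x · z ⊖ y · z
  ·-distribʳ-- x y z = begin
    (λ i → x i ⊖ y i) · z                   ≈⟨ ·-distribʳ-+ x _ z ⟩
    x · z ⊕ (λ i → - y i) · z               ≈⟨ +-congˡ (·-cong (λ i → sym (-1*x≈-x (y i))) (λ _ → refl)) ⟩
    x · z ⊕ (λ i → (- 1#) ⊛ y i) · z        ≈⟨ +-congˡ (·-scaleˡ (- 1#) y z) ⟩
    x · z ⊕ (- 1#) ⊛ y · z                  ≈⟨ +-congˡ (-1*x≈-x (y · z)) ⟩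
    x · z ⊖ y · z                           ∎

  -- Both sides are the matrix product xᵀ A y; the two finite sums are exchanged.
  ·-assoc : ∀ {n t} (x : Vector Carrier n) (A : Vector (Vector Carrier t) n) y →
            x · (λ i → A i · y) ≈ (λ j → x · (λ i → A i j)) · y
  ·-assoc x A y = begin
    x · (λ i → A i · y)                             ≈⟨ sum-cong-≋ (λ i → *-distribˡ-sum (x i) (λ j → A i j ⊛ y j)) ⟩
    sum (λ i → sum (λ j → x i ⊛ (A i j ⊛ y j)))     ≈⟨ ∑-comm (λ i j → x i ⊛ (A i j ⊛ y j)) ⟩
    sum (λ j → sum (λ i → x i ⊛ (A i j ⊛ y j)))     ≈⟨ sum-cong-≋ (λ j → sum-cong-≋ (λ i → sym (*-assoc (x i) (A i j) (y j)))) ⟩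
    sum (λ j → sum (λ i → (x i ⊛ A i j) ⊛ y j))     ≈⟨ sum-cong-≋ (λ j → sym (*-distribʳ-sum (y j) (λ i → x i ⊛ A i j))) ⟩
    (λ j → x · (λ i → A i j)) · y                   ∎

  -- The hypothesis bounds products rather than factors, so that different terms may vanish through
  -- different factors.
  ·-single : ∀ {n} (x y : Vector Carrier n) i →
             (∀ l → l ≢ i → x l ⊛ y l ≈ 0#) → x · y ≈ x i ⊛ y i
  ·-single {ℕ.suc n} x y i x*y≈0 = begin
    x · y                                             ≈⟨ sum-remove {i = i} (λ l → x l ⊛ y l) ⟩
    x i ⊛ y i ⊕ sum (removeAt (λ l → x l ⊛ y l) i)    ≈⟨ +-congˡ (sum-zero (λ l → x*y≈0 (punchIn i l) (punchInᵢ≢i i l))) ⟩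
    x i ⊛ y i ⊕ 0#                                    ≈⟨ +-identityʳ _ ⟩
    x i ⊛ y i                                         ∎

  unit : ∀ {n} → Fin n → Vector Carrier n
  unit i = updateAt (const 0#) i (const 1#)

  unit-diagonal : ∀ {n} (i : Fin n) → unit i i ≈ 1#
  unit-diagonal i = reflexive (updateAt-updates i (const 0#))

  unit-off-diagonal : ∀ {n} {i l : Fin n} → l ≢ i → unit i l ≈ 0#
  unit-off-diagonal {i = i} {l} l≢i = reflexive (updateAt-minimal l i (const 0#) l≢i)

  -- Stated for any `x` that looks like a unit vector up to `≈`, so that it also covers the image of
  -- a unit vector under `ι`.
  select : ∀ {n} {x : Vector Carrier n} y {i} →
           x i ≈ 1# → (∀ l → l ≢ i → x l ≈ 0#) → x · y ≈ y i
  select {x = x} y {i} xᵢ≈1 x≈0 = begin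
    x · y        ≈⟨ ·-single x y i (λ l l≢i → trans (*-congʳ (x≈0 l l≢i)) (zeroˡ (y l))) ⟩
    x i ⊛ y i    ≈⟨ *-congʳ xᵢ≈1 ⟩
    1# ⊛ y i     ≈⟨ *-identityˡ (y i) ⟩
    y i          ∎

  unit· : ∀ {n} (i : Fin n) y → unit i · y ≈ y i
  unit· i y = select y (unit-diagonal i) (λ _ → unit-off-diagonal)

  sumᴹ-at : ∀ {n t} (u : Vector (Vector Carrier n) t) i →
            sumᴹ (coordinateSpace R n) u i ≡ sum (λ j → u j i)
  sumᴹ-at {t = ℕ.zero}  u i = ≡.refl
  sumᴹ-at {t = ℕ.suc t} u i = ≡.cong (u zero i ⊕_) (sumᴹ-at (u ∘ suc) i)

  linComb-at : ∀ {n t} (c : Vector Carrier t) (u : Vector (Vector Carrier n) t) i →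
               linComb (coordinateSpace R n) c u i ≈ c · (λ j → u j i)
  linComb-at c u i = reflexive (sumᴹ-at (λ j l → c j ⊛ u j l) i)

  ·-linComb : ∀ {n t} (x : Vector Carrier n) c (u : Vector (Vector Carrier n) t) →
              x · linComb (coordinateSpace R n) c u ≈ c · (λ j → x · u j)
  ·-linComb x c u = begin
    x · linComb (coordinateSpace R _) c u    ≈⟨ ·-cong (λ _ → refl) (linComb-at c u) ⟩
    x · (λ i → c · (λ j → u j i))            ≈⟨ ·-cong {x = x} (λ _ → refl) (λ i → ·-comm c (λ j → u j i)) ⟩
    x · (λ i → (λ j → u j i) · c)            ≈⟨ ·-assoc x (λ i j → u j i) c ⟩
    (λ j → x · u j) · c                      ≈⟨ ·-comm _ c ⟩
    c · (λ j → x · u j)                      ∎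

  -- Lets `Span⊆` and `sumᴹ∈` carry orthogonality from generators to spans and sums.
  orthogonal-isSubspace : ∀ {n} (x : Vector Carrier n) →
                          IsSubspace (coordinateSpace R n) (λ y → x · y ≈ 0#)
  orthogonal-isSubspace x = record
    { respects = λ y≈z xy≈0 → trans (·-cong (λ _ → refl) (λ i → sym (y≈z i))) xy≈0
    ; 0ᴹ∈      = ·-zeroʳ x (λ _ → refl)
    ; +ᴹ∈      = λ {y} {z} xy≈0 xz≈0 → begin
        x · (λ i → y i ⊕ z i)    ≈⟨ ·-comm x _ ⟩
        (λ i → y i ⊕ z i) · x    ≈⟨ ·-distribʳ-+ y z x ⟩
        y · x ⊕ z · x            ≈⟨ +-cong (trans (·-comm y x) xy≈0) (trans (·-comm z x) xz≈0) ⟩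
        0# ⊕ 0#                  ≈⟨ +-identityˡ 0# ⟩
        0#                       ∎
    ; *ₗ∈      = λ α {y} xy≈0 → begin
        x · (λ i → α ⊛ y i)    ≈⟨ ·-comm x _ ⟩
        (λ i → α ⊛ y i) · x    ≈⟨ ·-scaleˡ α y x ⟩
        α ⊛ y · x              ≈⟨ *-congˡ (trans (·-comm y x) xy≈0) ⟩
        α ⊛ 0#                 ≈⟨ zeroʳ α ⟩
        0#                     ∎
    }

  column∈columnSpace : ∀ {n t} (A : Vector (Vector Carrier t) n) j →
                       transpose A j ∈ columnSpace R A
  column∈columnSpace A j =
    unit j , λ i → sym (trans (linComb-at (unit j) (transpose A) i) (unit· j (A i)))

-- Decidable equality and inverses in a finite Heyting field

module FiniteField {c ℓ₁ ℓ₂} (K : HeytingField c ℓ₁ ℓ₂) {N : ℕ}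
                   (order : HasOrder (CommutativeRing.setoid (fieldRing K)) N) where

  open CommutativeRing (fieldRing K) renaming (_+_ to _⊕_; _*_ to _⊛_; _-_ to _⊖_)
  open HeytingField K using (_#_; tight; #⇒invertible)
  open AbelianGroupProperties +-abelianGroup using (ε⁻¹≈ε)

  infix 4 _≈?_

  _≈?_ : Decidable _≈_
  _≈?_ = inj⇒≟ (Inverse⇒Injection order)

  -- An inverse is searched for in the finite carrier. If there is none, `x` cannot be apart from 0,
  -- since apartness would make `x ⊖ 0#` invertible; tightness then gives `x ≈ 0#`.
  ≉0⇒invertible : ∀ {x} → ¬ x ≈ 0# → ∃[ y ] y ⊛ x ≈ 1#
  ≉0⇒invertible {x} x≉0 with any? (λ i → Inverse.from order i ⊛ x ≈? 1#)
  ... | yes (i , yx≈1) = Inverse.from order i , yx≈1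
  ... | no  ∄y         = contradiction (proj₁ (tight x 0#) ¬x#0) x≉0
    where
    ¬x#0 : ¬ x # 0#
    ¬x#0 x#0 with y , yx≈1 , _ ← #⇒invertible x#0 =
      ∄y ( Inverse.to order y
         , trans (*-cong (Inverse.strictlyInverseʳ order y) x≈x-0) yx≈1)
      where
      x≈x-0 : x ≈ x ⊖ 0#
      x≈x-0 = sym (trans (+-congˡ ε⁻¹≈ε) (+-identityʳ x))

  *-cancel-0 : ∀ {x y} → ¬ x ≈ 0# → x ⊛ y ≈ 0# → y ≈ 0#
  *-cancel-0 {x} {y} x≉0 xy≈0 with z , zx≈1 ← ≉0⇒invertible x≉0 = begin
    y              ≈⟨ *-identityˡ y ⟨
    1# ⊛ y         ≈⟨ *-congʳ zx≈1 ⟨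
    (z ⊛ x) ⊛ y    ≈⟨ *-assoc z x y ⟩
    z ⊛ (x ⊛ y)    ≈⟨ *-congˡ xy≈0 ⟩
    z ⊛ 0#         ≈⟨ zeroʳ z ⟩
    0#             ∎
    where open SetoidReasoning setoid

-- Counting functions between finite sets and comparing exponents

-- Function extensionality is avoided because the code is assembled from the values one at a time.
funToFin-cong : ∀ {t N} {f g : Fin t → Fin N} → (∀ i → f i ≡ g i) → funToFin f ≡ funToFin g
funToFin-cong {ℕ.zero}  f≗g = ≡.refl
funToFin-cong {ℕ.suc t} f≗g =
  ≡.cong₂ combine (f≗g zero) (funToFin-cong (f≗g ∘ suc))

finToFun-injective : ∀ {t N} {i j : Fin (N ℕ.^ t)} →
                     (∀ l → finToFun {N} {t} i l ≡ finToFun j l) → i ≡ j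
finToFun-injective {t} {N} {i} {j} eq = begin
  i                               ≡⟨ funToFin-finToFin {t} {N} i ⟨
  funToFin (finToFun {N} {t} i)   ≡⟨ funToFin-cong eq ⟩
  funToFin (finToFun {N} {t} j)   ≡⟨ funToFin-finToFin {t} {N} j ⟩
  j                               ∎
  where open ≡.≡-Reasoning

funToFin-injective : ∀ {t N} {f g : Fin t → Fin N} → funToFin f ≡ funToFin g → ∀ i → f i ≡ g i
funToFin-injective {f = f} {g} eq i = begin
  f i                      ≡⟨ finToFun-funToFin f i ⟨
  finToFun (funToFin f) i  ≡⟨ ≡.cong (λ s → finToFun s i) eq ⟩
  finToFun (funToFin g) i  ≡⟨ finToFun-funToFin g i ⟩
  g i                      ∎
  where open ≡.≡-Reasoning

primePower>1 : ∀ {q} → IsPrimePower q → 1 ℕ.< q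
primePower>1 (p , e , p-prime , ≡.refl) = begin-strict
  1              <⟨ ℕ.nonTrivial⇒n>1 p {{prime⇒nonTrivial p-prime}} ⟩
  p              ≡⟨ ℕₚ.*-identityʳ p ⟨
  p * 1          ≤⟨ ℕₚ.*-monoʳ-≤ p (ℕₚ.m^n>0 p {{prime⇒nonZero p-prime}} e) ⟩
  p * p ℕ.^ e    ∎
  where open ℕₚ.≤-Reasoning

^-cancelʳ-≤ : ∀ q {s t} → 1 ℕ.< q → q ℕ.^ s ℕ.≤ q ℕ.^ t → s ℕ.≤ t
^-cancelʳ-≤ q 1<q qˢ≤qᵗ =
  ℕₚ.≮⇒≥ (λ t<s → ℕₚ.<⇒≱ (ℕₚ.^-monoʳ-< q 1<q t<s) qˢ≤qᵗ)

-- The pairing of Fⁿ with Lⁿ and its relation to rank supports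

module RankSupport {c ℓ₁ ℓ₂ : Level} {q m : ℕ} (E : FiniteFieldExtension c ℓ₁ ℓ₂ q m) where

  open FiniteFieldExtension E
  open IsRingMonomorphism ι-mono
  private
    module FD = DotProduct F
    module LD = DotProduct L
    module FG = AbelianGroupProperties F.+-abelianGroup
    module LG = AbelianGroupProperties L.+-abelianGroup
    module LK = FiniteField ext L-order

  open LD using (_·_)

  infix 8 _•_

  -- The F-bilinear pairing with values in L. One equation `μ • v ≈ 0` over L packs together the m
  -- equations over F saying that μ is orthogonal to the columns of Γ(v).
  _•_ : ∀ {n} → Vector F.Carrier n → Vector L.Carrier n → L.Carrier
  μ • v = (ι ∘ μ) · v

  ι-sum : ∀ {n} (x : Vector F.Carrier n) →
          ι (SemiringSum.sum F.semiring x) L.≈ SemiringSum.sum L.semiring (ι ∘ x)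
  ι-sum {ℕ.zero}  x = 0#-homo
  ι-sum {ℕ.suc n} x = L.trans (+-homo _ _) (L.+-congˡ (ι-sum (x ∘ suc)))

  ι-· : ∀ {n} (x y : Vector F.Carrier n) → ι (x FD.· y) L.≈ (ι ∘ x) · (ι ∘ y)
  ι-· x y = L.trans (ι-sum (λ i → x i F.* y i)) (SemiringSum.sum-cong-≋ L.semiring (λ i → *-homo (x i) (y i)))

  unit• : ∀ {n} (i : Fin n) v → FD.unit i • v L.≈ v i
  unit• i v = LD.select v
    (L.trans (⟦⟧-cong (FD.unit-diagonal i)) 1#-homo)
    (λ _ l≢i → L.trans (⟦⟧-cong (FD.unit-off-diagonal l≢i)) 0#-homo)

  •-distribʳ-- : ∀ {n} (μ ν : Vector F.Carrier n) v →
                 (λ i → μ i F.- ν i) • v L.≈ μ • v L.- ν • v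
  •-distribʳ-- μ ν v = L.trans
    (LD.·-cong (λ i → L.trans (+-homo _ _) (L.+-congˡ (-‿homo (ν i)))) (λ _ → L.refl))
    (LD.·-distribʳ-- (ι ∘ μ) (ι ∘ ν) v)

  -- The map μ ↦ (μ • w l)ₗ is additive, so a trivial kernel makes it injective from a set of qⁿ
  -- elements to one of (qᵐ)ᵗ elements.
  kernel-trivial⇒≤ : IsPrimePower q → ∀ {n t} (w : Vector (Vector L.Carrier n) t) →
    (∀ μ → (∀ l → μ • w l L.≈ L.0#) → ∀ i → μ i F.≈ F.0#) → n ℕ.≤ t * m
  kernel-trivial⇒≤ q-primePower {n} {t} w trivial =
    ^-cancelʳ-≤ q (primePower>1 q-primePower) (begin
      q ℕ.^ n            ≤⟨ injective⇒≤ encode-injective ⟩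
      (q ℕ.^ m) ℕ.^ t    ≡⟨ ℕₚ.^-*-assoc q m t ⟩
      q ℕ.^ (m * t)      ≡⟨ ≡.cong (q ℕ.^_) (ℕₚ.*-comm m t) ⟩
      q ℕ.^ (t * m)      ∎)
    where
    open ℕₚ.≤-Reasoning

    vec : Fin (q ℕ.^ n) → Vector F.Carrier n
    vec s = Inverse.from F-order ∘ finToFun s

    encode : Fin (q ℕ.^ n) → Fin ((q ℕ.^ m) ℕ.^ t)
    encode s = funToFin (λ l → Inverse.to L-order (vec s • w l))

    -- Equal codes put the difference of the two vectors into the kernel, so the vectors agree, and
    -- so do the digits of `s` and `s′`.
    encode-injective : ∀ {s s′} → encode s ≡ encode s′ → s ≡ s′
    encode-injective {s} {s′} eq = finToFun-injective {n} {q} (λ i →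
      Injection.injective (Inverse⇒Injection (Symmetry.inverse F-order))
        (FG.x∙y⁻¹≈ε⇒x≈y _ _ (trivial (λ i → vec s i F.- vec s′ i) (λ l →
          L.trans (•-distribʳ-- (vec s) (vec s′) (w l))
            (LG.x≈y⇒x∙y⁻¹≈ε (Injection.injective (Inverse⇒Injection L-order) (funToFin-injective eq l)))) i)))

  module _ (Γ : OrderedBasis E) where

    open OrderedBasis Γ

    -- Expanding each `v i` in the basis and exchanging sums leaves, as coefficient of `γ j`, the
    -- product of μ with column j of Γ(v).
    •-expand : ∀ {n} (μ : Vector F.Carrier n) v →
               μ • v L.≈ linComb (L/F E) (λ j → μ FD.· transpose (expand v) j) γ
    •-expand μ v = begin
      μ • v
        ≈⟨ LD.·-cong (λ _ → L.refl) (λ i → proj₂ (IsBasis.spanning isBasis {v i} _)) ⟩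
      (ι ∘ μ) · (λ i → (ι ∘ expand v i) · γ)
        ≈⟨ LD.·-assoc (ι ∘ μ) (λ i → ι ∘ expand v i) γ ⟩
      (λ j → (ι ∘ μ) · (λ i → ι (expand v i j))) · γ
        ≈⟨ LD.·-cong (λ j → L.sym (ι-· μ (transpose (expand v) j))) (λ _ → L.refl) ⟩
      (λ j → ι (μ FD.· transpose (expand v) j)) · γ
        ∎
      where open SetoidReasoning L.setoid

    -- Independence of `γ` makes each coefficient in `•-expand` vanish, so μ is orthogonal to the
    -- columns and hence to their span.
    •≈0⇒⟂support : ∀ {n} (μ : Vector F.Carrier n) {v} → μ • v L.≈ L.0# →
                   ∀ {x} → x ∈ rankSupport E Γ v → μ FD.· x F.≈ F.0#
    •≈0⇒⟂support μ {v} μv≈0 = Span⊆ (coordinateSpace F _) (FD.orthogonal-isSubspace μ)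
      (IsBasis.independent isBasis _ (L.trans (L.sym (•-expand μ v)) μv≈0))

    ⟂support⇒•≈0 : ∀ {n} (μ : Vector F.Carrier n) {v} →
                   (∀ {x} → x ∈ rankSupport E Γ v → μ FD.· x F.≈ F.0#) → μ • v L.≈ L.0#
    ⟂support⇒•≈0 μ {v} μ⟂ = L.trans (•-expand μ v) (LD.·-zeroˡ γ (λ j →
      L.trans (⟦⟧-cong (μ⟂ (FD.column∈columnSpace (expand v) j))) 0#-homo))

    module _ {p : Level} {n k : ℕ} (C : Code E p n k) where

      open Code C

      -- Such a μ is orthogonal to every rank support, hence to their sum Fⁿ; its product with the
      -- i-th unit vector is `μ i`.
      nondegenerate⇒separating : Nondegenerate E Γ C →
        ∀ μ → (∀ {v} → v ∈ words → μ • v L.≈ L.0#) → ∀ i → μ i F.≈ F.0#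
      nondegenerate⇒separating (_ , U⊆) μ μ⟂words i
        with t , u , u∈ , eᵢ≈∑u ← U⊆ {FD.unit i} _ = begin
        μ i                ≈⟨ FD.unit· i μ ⟨
        FD.unit i FD.· μ   ≈⟨ FD.·-comm (FD.unit i) μ ⟩
        μ FD.· FD.unit i   ≈⟨ respects (λ l → F.sym (eᵢ≈∑u l)) (sumᴹ∈ (coordinateSpace F n) (FD.orthogonal-isSubspace μ) ⟂u) ⟩
        F.0#               ∎
        where
        open SetoidReasoning F.setoid
        open IsSubspace (FD.orthogonal-isSubspace μ)
        ⟂u : ∀ j → μ FD.· u j F.≈ F.0#
        ⟂u j with (v , v∈) , uⱼ∈ ← u∈ j = •≈0⇒⟂support μ {v} (μ⟂words v∈) uⱼ∈

  -- The exchange argument in dimension t + 1, with n > t m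

  module Exchange (q-primePower : IsPrimePower q) (Γ : OrderedBasis E) {p : Level} {n t : ℕ}
                  (C : Code E p n (ℕ.suc t)) (nondegenerate : Nondegenerate E Γ C)
                  (n≰tm : ¬ n ℕ.≤ t * m) where

    open Code C
    private
      b = proj₁ dimension
      module B = IsBasis (proj₂ dimension)

    kernel-on-basis : ∀ μ → (∀ l → μ • b l L.≈ L.0#) → ∀ i → μ i F.≈ F.0#
    kernel-on-basis μ μb≈0 = nondegenerate⇒separating Γ C nondegenerate μ
      (λ v∈ → Span⊆ (coordinateSpace L n) (LD.orthogonal-isSubspace (ι ∘ μ)) μb≈0 (B.spanning v∈))

    minimal : Minimal E Γ C
    minimal v v′ v∈ v′∈ σv′⊆σv = proportional
      where
      a  = proj₁ (B.spanning v∈)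
      a′ = proj₁ (B.spanning v′∈)

      •v≈a· : ∀ μ → μ • v L.≈ a · (λ l → μ • b l)
      •v≈a· μ = L.trans (LD.·-cong (λ _ → L.refl) (proj₂ (B.spanning v∈)))
                        (LD.·-linComb (ι ∘ μ) a b)

      •v′≈a′· : ∀ μ → μ • v′ L.≈ a′ · (λ l → μ • b l)
      •v′≈a′· μ = L.trans (LD.·-cong (λ _ → L.refl) (proj₂ (B.spanning v′∈)))
                          (LD.·-linComb (ι ∘ μ) a′ b)

      -- The inclusion σ(v′) ⊆ σ(v) reverses for orthogonal complements. Only here does it enter.
      •v≈0⇒•v′≈0 : ∀ μ → μ • v L.≈ L.0# → μ • v′ L.≈ L.0#
      •v≈0⇒•v′≈0 μ μv≈0 =
        ⟂support⇒•≈0 Γ μ (λ x∈ → •≈0⇒⟂support Γ μ {v} μv≈0 (σv′⊆σv x∈))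

      v≈ : ∀ i → v i L.≈ a · (λ l → b l i)
      v≈ i = L.trans (proj₂ (B.spanning v∈) i) (LD.linComb-at a b i)

      v′≈ : ∀ i → v′ i L.≈ a′ · (λ l → b l i)
      v′≈ i = L.trans (proj₂ (B.spanning v′∈) i) (LD.linComb-at a′ b i)

      module Pivot (i : Fin (ℕ.suc t)) (aᵢ≉0 : ¬ a i L.≈ L.0#) where

        open SetoidReasoning L.setoid

        aᵢ⁻¹ = proj₁ (LK.≉0⇒invertible aᵢ≉0)
        -- Comparing i-th coordinates, this is the only scalar for which v′ = β v is possible.
        β    = a′ i L.* aᵢ⁻¹

        -- The coordinates of v′ - β v in the basis `b`.
        d : Vector L.Carrier (ℕ.suc t)
        d l = a′ l L.- β L.* a l

        dᵢ≈0 : d i L.≈ L.0#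
        dᵢ≈0 = LG.x≈y⇒x∙y⁻¹≈ε (begin
          a′ i                      ≈⟨ L.*-identityʳ (a′ i) ⟨
          a′ i L.* L.1#             ≈⟨ L.*-congˡ (proj₂ (LK.≉0⇒invertible aᵢ≉0)) ⟨
          a′ i L.* (aᵢ⁻¹ L.* a i)   ≈⟨ L.*-assoc (a′ i) aᵢ⁻¹ (a i) ⟨
          β L.* a i                 ∎)

        d≈0⇒multiple : (∀ l → d l L.≈ L.0#) → ∀ s → v′ s L.≈ β L.* v s
        d≈0⇒multiple d≈0 s = begin
          v′ s                                ≈⟨ v′≈ s ⟩
          a′ · (λ l → b l s)                  ≈⟨ LD.·-cong {y = λ l → b l s} (λ l → LG.x∙y⁻¹≈ε⇒x≈y _ _ (d≈0 l)) (λ _ → L.refl) ⟩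
          (λ l → β L.* a l) · (λ l → b l s)   ≈⟨ LD.·-scaleˡ β a (λ l → b l s) ⟩
          β L.* a · (λ l → b l s)             ≈⟨ L.*-congˡ (v≈ s) ⟨
          β L.* v s                           ∎

        -- A nonzero `d j` allows v and v′ to replace `b i` and `b j`. Products with v′ vanish
        -- whenever those with v do, so v′ need not be listed and t vectors detect every nonzero μ.
        d≉0⇒≤ : ∀ j → ¬ d j L.≈ L.0# → n ℕ.≤ t * m
        d≉0⇒≤ j dⱼ≉0 = kernel-trivial⇒≤ q-primePower w
          (λ μ μw≈0 → kernel-on-basis μ (basis-killed μ μw≈0))
          where
          -- Guarantees that v, placed at position i, survives the removal of position j.
          j≢i : j ≢ i
          j≢i ≡.refl = dⱼ≉0 dᵢ≈0

          w′ : Vector (Vector L.Carrier n) (ℕ.suc t)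
          w′ = updateAt b i (const v)

          w : Vector (Vector L.Carrier n) t
          w = removeAt w′ j

          module _ (μ : Vector F.Carrier n) (μw≈0 : ∀ l → μ • w l L.≈ L.0#) where

            w′-killed : ∀ {l} → j ≢ l → μ • w′ l L.≈ L.0#
            w′-killed j≢l = ≡.subst (λ l → μ • w′ l L.≈ L.0#) (punchIn-punchOut j≢l)
                                    (μw≈0 (punchOut j≢l))

            v-killed : μ • v L.≈ L.0#
            v-killed = ≡.subst (λ x → μ • x L.≈ L.0#) (updateAt-updates i b) (w′-killed j≢i)

            others-killed : ∀ {l} → l ≢ i → l ≢ j → μ • b l L.≈ L.0#
            others-killed {l} l≢i l≢j =
              ≡.subst (λ x → μ • x L.≈ L.0#) (updateAt-minimal l i b l≢i) (w′-killed (l≢j ∘ ≡.sym))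

            y : Vector L.Carrier (ℕ.suc t)
            y l = μ • b l

            a·y≈0 : a · y L.≈ L.0#
            a·y≈0 = L.trans (L.sym (•v≈a· μ)) v-killed

            -- In coordinates this is μ • v′ - β (μ • v), and μ kills both v and v′.
            d·y≈0 : d · y L.≈ L.0#
            d·y≈0 = begin
              d · y                                ≈⟨ LD.·-distribʳ-- a′ (λ l → β L.* a l) y ⟩
              a′ · y L.- (λ l → β L.* a l) · y     ≈⟨ LG.x≈y⇒x∙y⁻¹≈ε (begin
                a′ · y                   ≈⟨ •v′≈a′· μ ⟨
                μ • v′                   ≈⟨ •v≈0⇒•v′≈0 μ v-killed ⟩
                L.0#                     ≈⟨ L.zeroʳ β ⟨
                β L.* L.0#               ≈⟨ L.*-congˡ a·y≈0 ⟨
                β L.* a · y              ≈⟨ LD.·-scaleˡ β a y ⟨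
                (λ l → β L.* a l) · y    ∎) ⟩
              L.0#                                 ∎

            yⱼ≈0 : y j L.≈ L.0#
            -- Only the j-th term of `d · y` survives: the i-th has `d i ≈ 0` by the choice of β,
            -- and the others have `y l ≈ 0`.
            yⱼ≈0 = LK.*-cancel-0 dⱼ≉0 (L.trans (L.sym (LD.·-single d y j off)) d·y≈0)
              where
              off : ∀ l → l ≢ j → d l L.* y l L.≈ L.0#
              off l l≢j with l ≟ i
              ... | yes ≡.refl = L.trans (L.*-congʳ dᵢ≈0) (L.zeroˡ (y l))
              ... | no  l≢i    = L.trans (L.*-congˡ (others-killed l≢i l≢j)) (L.zeroʳ (d l))

            yₗ≈0 : ∀ l → l ≢ i → y l L.≈ L.0#
            yₗ≈0 l l≢i with l ≟ j
            ... | yes ≡.refl = yⱼ≈0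
            ... | no  l≢j    = others-killed l≢i l≢j

            basis-killed : ∀ l → y l L.≈ L.0#
            basis-killed l with l ≟ i
            ... | no  l≢i    = yₗ≈0 l l≢i
            -- The replaced vector `b i` comes last: with all other products zero, `a · y ≈ 0`
            -- reduces to `a i` times `y i`, and `a i` is nonzero.
            ... | yes ≡.refl = LK.*-cancel-0 aᵢ≉0 (L.trans
              (L.sym (LD.·-single a y l (λ l′ l′≢l →
                L.trans (L.*-congˡ (yₗ≈0 l′ l′≢l)) (L.zeroʳ (a l′)))))
              a·y≈0)

        multiple : ∃[ α ] (∀ s → v′ s L.≈ α L.* v s)
        multiple with all? (λ l → d l LK.≈? L.0#)
        ... | yes d≈0 = β , d≈0⇒multiple d≈0
        -- A nonzero coordinate of v′ - β v would force n ≤ t m.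
        ... | no  d≉0 with j , dⱼ≉0 ← ¬∀⟶∃¬ _ _ (λ l → d l LK.≈? L.0#) d≉0 =
          contradiction (d≉0⇒≤ j dⱼ≉0) n≰tm

      proportional : ∃[ α ] (∀ s → v′ s L.≈ α L.* v s)
      proportional with all? (λ l → a l LK.≈? L.0#)
      ... | no  a≉0 with i , aᵢ≉0 ← ¬∀⟶∃¬ _ _ (λ l → a l LK.≈? L.0#) a≉0 = Pivot.multiple i aᵢ≉0
      -- Here v = 0, so every unit vector kills v and therefore v′; these products are the
      -- coordinates of v′, so v′ = 0 and the scalar 0 serves.
      ... | yes a≈0 = L.0# , λ s → begin
        v′ s               ≈⟨ unit• s v′ ⟨
        FD.unit s • v′     ≈⟨ •v≈0⇒•v′≈0 (FD.unit s) (L.trans (unit• s v) (v≈0 s)) ⟩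
        L.0#               ≈⟨ L.zeroˡ (v s) ⟨
        L.0# L.* v s       ∎
        where
        open SetoidReasoning L.setoid
        v≈0 : ∀ s → v s L.≈ L.0#
        v≈0 s = L.trans (v≈ s) (LD.·-zeroˡ (λ l → b l s) a≈0)

proposition6p2 : ∀ {c ℓ₁ ℓ₂ p : Level} (q n m k : ℕ) →
    IsPrimePower q → n ≥ 1 → m ≥ 1 → k ≥ 1 →
    (E : FiniteFieldExtension c ℓ₁ ℓ₂ q m) (Γ : OrderedBasis E)
    (C : Code E p n k) →
    Nondegenerate E Γ C →
    n ≥ (k ∸ 1) * m + 1 →
    Minimal E Γ C
proposition6p2 q n m (ℕ.suc t) q-primePower _ _ _ E Γ C nondegenerate n≥tm+1 =
  RankSupport.Exchange.minimal E q-primePower Γ C nondegenerate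
    -- With k = t + 1, `k ∸ 1` computes to `t`; after commuting the sum, the bound reads
    -- `suc (t * m) ≤ n`, which is `t * m < n`.
    (ℕₚ.<⇒≱ (≡.subst (ℕ._≤ n) (ℕₚ.+-comm (t * m) 1) n≥tm+1))
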